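{- Let $\mathcal{C}=\{C_1,\dots,C_g\}$ be a cycle system for the matroid $M$, $g=g(M)$. Let $e\in\mathcal{C}_{[g]}\cap C_i$ for some $i$. Let $\mathcal{C}'=\{C_1,\dots,C_{i-1},C_{i+1},\dots,C_g\}$, a cycle system for $M\setminus e$, and, if $e$ is a non-loop, let $\mathcal{C}''=\{C_1\setminus e,\dots,C_g\setminus e\}$, a cycle system for $M/e$. 1. There is an injective mapping of coparking functions $P^*(\mathcal{C}')\hookrightarrow P^*(\mathcal{C})$ given by $$(a_1,\dots,a_{i-1},a_{i+1},\dots,a_g)\mapsto(a_1,\dots,a_{i-1},0,a_{i+1},\dots,a_g).$$ Its image is $\{(a_1,\dots,a_g)\in P^*(\mathcal{C}): a_i=0\}$. If $e$ is a loop, then this mapping is bijective. 2. Suppose $e$ is a non-loop. Then there is an injective mapping of coparking functions $P^*(\mathcal{C}'')\hookrightarrow P^*(\mathcal{C})$ given by $$(a_1,\dots,a_g)\mapsto(a_1,\dots,a_{i-1},a_i+1,a_{i+1},\dots,a_g).$$ Its image is $\{(a_1,\dots,a_g)\in P^*(\mathcal{C}): a_i>0\}$.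
   Context: Matroids are on finite ground sets; $g(M)=|E(M)|-r(M)$ is the corank. $\mathbb{N}$ includes $0$, and $\mathbb{N}^0=\{()\}$. A *cycle* of $M$ is a union of circuits. $M\setminus e$, $M/e$ are deletion and contraction; $C_j\setminus e=C_j\setminus\{e\}$. Unique union: for a family $\mathcal{A}=\{A_1,\dots,A_g\}$ of subsets of a set and $\sigma\subseteq[g]=\{1,\dots,g\}$, $\mathcal{A}_\sigma$ is the set of elements $e\in\bigcup_{i\in\sigma}A_i$ for which there is exactly one $i\in\sigma$ with $e\in A_i$. A *cycle system* for $M$ is a collection $\mathcal{C}=\{C_1,\dots,C_g\}$ of cycles of $M$ with $g=g(M)$ such that for every nonempty $\sigma\subseteq[g]$ the unique union $\mathcal{C}_\sigma$ is dependent in $M$. A *coparking function* with respect to $\mathcal{C}$ is a vector $a=(a_1,\dots,a_g)\in\mathbb{N}^g$ such that for every nonempty $\sigma\subseteq[g]$ there is some $i\in\sigma$ with $a_i<|C_i\cap\mathcal{C}_\sigma|$ (if $g=0$, the only one is $()$). $P^*(\mathcal{C})$ is the set of coparking functions. Coordinates of elements of $P^*(\mathcal{C}')$ are indexed by $[g]\setminus\{i\}$. -}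

module Defs where

open import Data.Empty using (⊥-elim)
open import Data.Fin.Base using (Fin; zero; suc)
open import Data.Fin.Properties using (all?; any?) renaming (_≟_ to _≟ᶠ_)
open import Data.Fin.Subset
open import Data.Fin.Subset.Properties
open import Data.List.Base as List using (List)
open import Data.List.Extrema.Nat using (max)
open import Data.List.Relation.Unary.All using (All)
open import Data.Nat.Base using (ℕ; zero; suc; _∸_; _<_; s≤s)
open import Data.Product using (_×_; _,_; ∃; ∃!)
open import Data.Sum.Base using (inj₁; inj₂)
open import Data.Vec.Base using (Vec; []; _∷_; lookup; tabulate; here; there)
open import Function.Base using (_∘_)
open import Level using (0ℓ)
open import Relation.Binary.PropositionalEquality
open import Relation.Nullary using (¬_; yes; no; does; ¬?; contradiction)
open import Relation.Nullary.Decidable using (_×-dec_; _→-dec_; map′)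
import Relation.Unary as U
open U using (Pred)

private
  variable
    n g k l : ℕ

-- The ground set E is an arbitrary subset of an ambient Fin n, so that a minor
-- of M lives in the same ambient set as M. Independence is decidable, as it is
-- classically for any predicate on a finite set.

record Matroid (n : ℕ) : Set₁ where
  field
    E         : Subset n
    Indep     : Pred (Subset n) 0ℓ
    indep?    : U.Decidable Indep
    indep⇒⊆E  : ∀ {I} → Indep I → I ⊆ E
    indep-⊥   : Indep ⊥
    indep-⊆   : ∀ {I J} → I ⊆ J → Indep J → Indep I
    augment   : ∀ {I J} → Indep I → Indep J → ∣ I ∣ < ∣ J ∣ →
                ∃ λ x → x ∈ J × x ∉ I × Indep (I ∪ ⁅ x ⁆)

open Matroid

subsets : ∀ n → List (Subset n)
subsets zero    = List.[ [] ]
subsets (suc n) = List.map (outside ∷_) (subsets n) List.++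
                  List.map (inside ∷_) (subsets n)

rank : Matroid n → ℕ
rank M = max 0 (List.map ∣_∣ (List.filter (indep? M) (subsets _)))

corank : Matroid n → ℕ
corank M = ∣ E M ∣ ∸ rank M

Dependent : Matroid n → Pred (Subset n) 0ℓ
Dependent M X = X ⊆ E M × ¬ Indep M X

Circuit : Matroid n → Pred (Subset n) 0ℓ
Circuit M X = Dependent M X × (∀ {Y} → Y ⊂ X → Indep M Y)

Cycle : Matroid n → Pred (Subset n) 0ℓ
Cycle M X = ∃ λ Ds → All (Circuit M) Ds × X ≡ ⋃ Ds

Loop : Matroid n → Pred (Fin n) 0ℓ
Loop M e = Circuit M ⁅ e ⁆

NonLoop : Matroid n → Pred (Fin n) 0ℓ
NonLoop M e = e ∈ E M × ¬ Loop M e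

private
  ∪-least : ∀ {p q r : Subset n} → p ⊆ r → q ⊆ r → p ∪ q ⊆ r
  ∪-least {p = p} {q} p⊆r q⊆r x∈ with x∈p∪q⁻ p q x∈
  ... | inj₁ x∈p = p⊆r x∈p
  ... | inj₂ x∈q = q⊆r x∈q

  ∪-monoˡ : ∀ {p q : Subset n} (r : Subset n) → p ⊆ q → p ∪ r ⊆ q ∪ r
  ∪-monoˡ {q = q} r p⊆q = ∪-least (p⊆p∪q r ∘ p⊆q) (q⊆p∪q q r)

  ∉-∪ : ∀ {p q : Subset n} {x} → x ∉ p → x ∉ q → x ∉ p ∪ q
  ∉-∪ {p = p} {q} x∉p x∉q x∈ with x∈p∪q⁻ p q x∈
  ... | inj₁ x∈p = x∉p x∈p
  ... | inj₂ x∈q = x∉q x∈q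

  ∉⁅⁆ : ∀ {p : Subset n} {x e} → x ∈ p → e ∉ p → e ∉ ⁅ x ⁆
  ∉⁅⁆ {p = p} {x} x∈p e∉p e∈x = e∉p (subst (_∈ p) (sym (x∈⁅y⁆⇒x≡y x e∈x)) x∈p)

  ⊆-remove : ∀ {p q : Subset n} {e} → e ∉ p → p ⊆ q → p ⊆ q - e
  ⊆-remove e∉p p⊆q x∈p = x∈p∧x≢y⇒x∈p-y (p⊆q x∈p) λ { refl → e∉p x∈p }

  ∣p∪⁅x⁆∣ : ∀ {x} (p : Subset n) → x ∉ p → ∣ p ∪ ⁅ x ⁆ ∣ ≡ suc ∣ p ∣
  ∣p∪⁅x⁆∣ {x = zero}  (inside  ∷ p) x∉p = contradiction here x∉p
  ∣p∪⁅x⁆∣ {x = zero}  (outside ∷ p) x∉p = cong (suc ∘ ∣_∣) (∪-identityʳ p)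
  ∣p∪⁅x⁆∣ {x = suc x} (inside  ∷ p) x∉p = cong suc (∣p∪⁅x⁆∣ p (x∉p ∘ there))
  ∣p∪⁅x⁆∣ {x = suc x} (outside ∷ p) x∉p = ∣p∪⁅x⁆∣ p (x∉p ∘ there)

infixl 5 _∖_

_∖_ : Matroid n → Fin n → Matroid n
M ∖ e = record
  { E        = E M - e
  ; Indep    = λ I → e ∉ I × Indep M I
  ; indep?   = λ I → ¬? (e ∈? I) ×-dec indep? M I
  ; indep⇒⊆E = λ (e∉I , iI) → ⊆-remove e∉I (indep⇒⊆E M iI)
  ; indep-⊥  = ∉⊥ , indep-⊥ M
  ; indep-⊆  = λ I⊆J (e∉J , iJ) → e∉J ∘ I⊆J , indep-⊆ M I⊆J iJ
  ; augment  = λ (e∉I , iI) (e∉J , iJ) I<J →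
      let x , x∈J , x∉I , iIx = augment M iI iJ I<J
      in  x , x∈J , x∉I , ∉-∪ e∉I (∉⁅⁆ x∈J e∉J) , iIx
  }

nonLoop⇒indep : (M : Matroid n) {e : Fin n} → NonLoop M e → Indep M ⁅ e ⁆
nonLoop⇒indep M {e} (e∈E , ¬loop) with indep? M ⁅ e ⁆
... | yes i = i
... | no ¬i = ⊥-elim (¬loop ((e⊆E , ¬i) , minimal))
  where
  e⊆E : ⁅ e ⁆ ⊆ E M
  e⊆E x∈ = subst (_∈ E M) (sym (x∈⁅y⁆⇒x≡y e x∈)) e∈E

  minimal : ∀ {Y} → Y ⊂ ⁅ e ⁆ → Indep M Y
  minimal {Y} (Y⊆e , z , z∈e , z∉Y) = subst (Indep M) (sym (Empty-unique empty)) (indep-⊥ M)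
    where
    empty : Empty Y
    empty (y , y∈Y) = z∉Y (subst (_∈ Y)
      (trans (x∈⁅y⁆⇒x≡y e (Y⊆e y∈Y)) (sym (x∈⁅y⁆⇒x≡y e z∈e))) y∈Y)

-- Only contraction of a non-loop is defined: there I is independent in M / e
-- iff e ∉ I and I ∪ {e} is independent in M.

contract : (M : Matroid n) (e : Fin n) → NonLoop M e → Matroid n
contract M e nl = record
  { E        = E M - e
  ; Indep    = λ I → e ∉ I × Indep M (I ∪ ⁅ e ⁆)
  ; indep?   = λ I → ¬? (e ∈? I) ×-dec indep? M (I ∪ ⁅ e ⁆)
  ; indep⇒⊆E = λ (e∉I , iI) → ⊆-remove e∉I (indep⇒⊆E M iI ∘ p⊆p∪q ⁅ e ⁆)
  ; indep-⊥  = ∉⊥ , subst (Indep M) (sym (∪-identityˡ ⁅ e ⁆)) (nonLoop⇒indep M nl)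
  ; indep-⊆  = λ I⊆J (e∉J , iJ) → e∉J ∘ I⊆J , indep-⊆ M (∪-monoˡ ⁅ e ⁆ I⊆J) iJ
  ; augment  = aug
  }
  where
  aug : ∀ {I J} → e ∉ I × Indep M (I ∪ ⁅ e ⁆) → e ∉ J × Indep M (J ∪ ⁅ e ⁆) → ∣ I ∣ < ∣ J ∣ →
        ∃ λ x → x ∈ J × x ∉ I × e ∉ I ∪ ⁅ x ⁆ × Indep M ((I ∪ ⁅ x ⁆) ∪ ⁅ e ⁆)
  aug {I} {J} (e∉I , iI) (e∉J , iJ) I<J
    with x , x∈Je , x∉Ie , iIex ← augment M iI iJ
           (subst₂ _<_ (sym (∣p∪⁅x⁆∣ I e∉I)) (sym (∣p∪⁅x⁆∣ J e∉J)) (s≤s I<J))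
    with x∈p∪q⁻ J ⁅ e ⁆ x∈Je
  ... | inj₂ x∈e = contradiction (q⊆p∪q I ⁅ e ⁆ x∈e) x∉Ie
  ... | inj₁ x∈J = x , x∈J , x∉Ie ∘ p⊆p∪q ⁅ e ⁆ , ∉-∪ e∉I (∉⁅⁆ x∈J e∉J) ,
                   subst (Indep M) swap iIex
    where
    swap : (I ∪ ⁅ e ⁆) ∪ ⁅ x ⁆ ≡ (I ∪ ⁅ x ⁆) ∪ ⁅ e ⁆
    swap = trans (∪-assoc I ⁅ e ⁆ ⁅ x ⁆)
             (trans (cong (I ∪_) (∪-comm ⁅ e ⁆ ⁅ x ⁆))
                    (sym (∪-assoc I ⁅ x ⁆ ⁅ e ⁆)))

InExactlyOne : Vec (Subset n) g → Subset g → Pred (Fin n) 0ℓ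
InExactlyOne A σ e = ∃! _≡_ λ i → i ∈ σ × e ∈ lookup A i

inExactlyOne? : (A : Vec (Subset n) g) (σ : Subset g) → U.Decidable (InExactlyOne A σ)
inExactlyOne? A σ e = any? λ i → B? i ×-dec
  map′ (λ h {j} → h j) (λ h j → h {j}) (all? λ j → B? j →-dec (i ≟ᶠ j))
  where
  B? : U.Decidable (λ i → i ∈ σ × e ∈ lookup A i)
  B? i = (i ∈? σ) ×-dec (e ∈? lookup A i)

uniqueUnion : Vec (Subset n) g → Subset g → Subset n
uniqueUnion A σ = tabulate λ e → does (inExactlyOne? A σ e)

record IsCycleSystem (M : Matroid n) (C : Vec (Subset n) g) : Set where
  field
    size      : g ≡ corank M
    cycle     : ∀ i → Cycle M (lookup C i)
    dependent : ∀ σ → Nonempty σ → Dependent M (uniqueUnion C σ)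

P* : Vec (Subset n) g → Pred (Vec ℕ g) 0ℓ
P* C a = ∀ σ → Nonempty σ →
  ∃ λ i → i ∈ σ × lookup a i < ∣ lookup C i ∩ uniqueUnion C σ ∣

Image : (Vec ℕ k → Vec ℕ l) → Pred (Vec ℕ k) 0ℓ → Pred (Vec ℕ l) 0ℓ
Image f P b = ∃ λ a → P a × f a ≡ b

record IsInjectiveMap (f : Vec ℕ k → Vec ℕ l)
                      (P : Pred (Vec ℕ k) 0ℓ) (Q : Pred (Vec ℕ l) 0ℓ) : Set where
  field
    mapsTo    : ∀ {a} → P a → Q (f a)
    injective : ∀ {a b} → P a → P b → f a ≡ f b → a ≡ b

record IsBijectiveMap (f : Vec ℕ k → Vec ℕ l)
                      (P : Pred (Vec ℕ k) 0ℓ) (Q : Pred (Vec ℕ l) 0ℓ) : Set where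
  field
    isInjectiveMap : IsInjectiveMap f P Q
    surjective     : ∀ {b} → Q b → Image f P b

{-# OPTIONS --safe #-}
module Submission where

-- The element e lies in C_i and in no other C_j. Hence e ∈ C_i ∩ C_σ whenever
-- i ∈ σ, so for a_i = 0 the coparking condition is automatic for these σ and only
-- the σ avoiding i, i.e. those of C′, matter. Passing to C″ lowers exactly the
-- thresholds at i by one, which a_i ↦ a_i + 1 makes up for.
--
-- If e is a loop and some a ∈ P*(C) has a_i > 0, then the sets C_σ ∖ {e} are all
-- nonempty. One can then keep deleting elements other than e, each lying in
-- just one of the remaining cycles, until the corank is 0; this is absurd, as e is
-- still a loop.
--
-- For the cycle systems: an element of a cycle is not a coloop, so deleting e keeps
-- the rank, and contracting a non-loop e lowers it by one. That X ∖ {e} is a cycle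
-- of M / e is seen by exchange, using that X ⊆ E is a cycle iff each x ∈ X
-- completes some independent I ⊆ X to a dependent set.

open import Defs
open import Data.Bool.Properties using (¬-not)
open import Data.Fin.Base using (Fin; zero; punchIn; punchOut)
open import Data.Fin.Properties using (punchIn-injective; punchIn-punchOut; punchInᵢ≢i; any?)
  renaming (_≟_ to _≟ᶠ_)
open import Data.Fin.Subset
  using (Subset; inside; outside; _∈_; _∉_; _⊆_; _∩_; _∪_; _-_; ⊤; ⊥; ⋃; ⁅_⁆; ∣_∣; Nonempty)
open import Data.Fin.Subset.Properties
open import Data.List.Base as List using ([]; _∷_; allFin)
open import Data.List.Extrema.Nat using (argmax-sel; xs≤max)
open import Data.List.Membership.Propositional using () renaming (_∈_ to _∈ₗ_)
open import Data.List.Membership.Propositional.Properties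
  using (∈-map⁺; ∈-map⁻; ∈-filter⁺; ∈-filter⁻; ∈-++⁺ˡ; ∈-++⁺ʳ; ∈-allFin)
open import Data.List.Relation.Unary.All as All using (All; []; _∷_)
open import Data.List.Relation.Unary.Any using (here; there)
open import Data.Nat.Base using (ℕ; zero; suc; pred; _+_; _∸_; _≤_; _<_; _>_; z≤n; s≤s; s<s⁻¹)
open import Data.Nat.Induction using (<-wellFounded)
open import Data.Nat.Properties
  using (≤-antisym; ≤-reflexive; ≤-<-trans; <-irrefl; ≤⇒≯; ≰⇒>; _≤?_; m∸n≡0⇒m≤n; m∸n+n≡m;
         m≤n+m; +-suc; pred[m∸n]≡m∸[1+n])
open import Data.Product.Base using (∃; _×_; _,_; proj₁; proj₂)
open import Data.Sum.Base using (inj₁; inj₂; [_,_]′)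
open import Data.Vec.Base
  using (Vec; []; _∷_; lookup; map; insertAt; removeAt; updateAt; here; there)
open import Data.Vec.Properties
  using (lookup-map; lookup∘tabulate; []=⇒lookup; lookup⇒[]=; insertAt-lookup; insertAt-punchIn;
         insertAt-removeAt; removeAt-insertAt; lookup∘updateAt; lookup∘updateAt′;
         updateAt-updateAt; updateAt-id; updateAt-id-local)
open import Function.Base using (_∘_; id; case_of_)
open import Induction.WellFounded using (Acc; acc)
open import Level using (0ℓ)
open import Relation.Binary.PropositionalEquality
  using (_≡_; _≢_; refl; sym; trans; cong; cong₂; subst; subst₂; module ≡-Reasoning)
open import Relation.Nullary using (¬_; yes; no; ¬?; contradiction)
open import Relation.Nullary.Decidable using (_×-dec_; decidable-stable; dec-true)
open import Relation.Unary using (Pred; _≐_)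

open Matroid
open IsCycleSystem

private
  variable
    n g k : ℕ

-- Finite subsets: removing and adding one element.

∪-lub : ∀ {p q r : Subset n} → p ⊆ r → q ⊆ r → p ∪ q ⊆ r
∪-lub {p = p} {q} p⊆r q⊆r = [ p⊆r , q⊆r ]′ ∘ x∈p∪q⁻ p q

∪-monoˡ-⊆ : ∀ {p q : Subset n} (r : Subset n) → p ⊆ q → p ∪ r ⊆ q ∪ r
∪-monoˡ-⊆ {q = q} r p⊆q = ∪-lub (p⊆p∪q r ∘ p⊆q) (q⊆p∪q q r)

⁅x⁆⊆ : ∀ {x} {p : Subset n} → x ∈ p → ⁅ x ⁆ ⊆ p
⁅x⁆⊆ {x = x} {p} x∈p y∈ = subst (_∈ p) (sym (x∈⁅y⁆⇒x≡y x y∈)) x∈p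

x∈p∪⁅x⁆ : ∀ x (p : Subset n) → x ∈ p ∪ ⁅ x ⁆
x∈p∪⁅x⁆ x p = q⊆p∪q p ⁅ x ⁆ (x∈⁅x⁆ x)

p-x⊆p : ∀ (p : Subset n) x → p - x ⊆ p
p-x⊆p p x = p─q⊆p p ⁅ x ⁆

-- Removal is idempotent, but it would be strictly decreasing if x were still present.
x∉p-x : ∀ (p : Subset n) x → x ∉ p - x
x∉p-x p x x∈ = ⊂-irref (p─q─q≡p─q p ⁅ x ⁆) (x∈p⇒p-x⊂p x∈)

x∈p-y⇒x≢y : ∀ (p : Subset n) {x y} → x ∈ p - y → x ≢ y
x∈p-y⇒x≢y p {x} x∈ refl = x∉p-x p x x∈

p⊆q∧x∉p⇒p⊆q-x : ∀ {p q : Subset n} {x} → p ⊆ q → x ∉ p → p ⊆ q - x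
p⊆q∧x∉p⇒p⊆q-x p⊆q x∉p y∈p = x∈p∧x≢y⇒x∈p-y (p⊆q y∈p) λ { refl → x∉p y∈p }

x∉p⇒p-x≡p : ∀ {p : Subset n} {x} → x ∉ p → p - x ≡ p
x∉p⇒p-x≡p {p = p} {x} x∉p = ⊆-antisym (p-x⊆p p x) (p⊆q∧x∉p⇒p⊆q-x id x∉p)

p⊆p-x∪⁅x⁆ : ∀ (p : Subset n) x → p ⊆ (p - x) ∪ ⁅ x ⁆
p⊆p-x∪⁅x⁆ p x {y} y∈p with y ≟ᶠ x
... | yes refl = x∈p∪⁅x⁆ x (p - x)
... | no  y≢x  = p⊆p∪q ⁅ x ⁆ (x∈p∧x≢y⇒x∈p-y y∈p y≢x)

p-x∪⁅x⁆⊆p : ∀ {p : Subset n} {x} → x ∈ p → (p - x) ∪ ⁅ x ⁆ ⊆ p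
p-x∪⁅x⁆⊆p {p = p} {x} x∈p = ∪-lub (p-x⊆p p x) (⁅x⁆⊆ x∈p)

x∈p⇒∣p∣≡1+∣p-x∣ : ∀ {p : Subset n} {x} → x ∈ p → ∣ p ∣ ≡ suc ∣ p - x ∣
-- At the head, removal subtracts `⊥` from the tail.
x∈p⇒∣p∣≡1+∣p-x∣ {p = _ ∷ p}       here        = cong (suc ∘ ∣_∣) (sym (p─⊥≡p p))
x∈p⇒∣p∣≡1+∣p-x∣ {p = inside  ∷ p} (there x∈p) = cong suc (x∈p⇒∣p∣≡1+∣p-x∣ x∈p)
x∈p⇒∣p∣≡1+∣p-x∣ {p = outside ∷ p} (there x∈p) = x∈p⇒∣p∣≡1+∣p-x∣ x∈p

x∉p⇒∣p∪⁅x⁆∣≡1+∣p∣ : ∀ {p : Subset n} {x} → x ∉ p → ∣ p ∪ ⁅ x ⁆ ∣ ≡ suc ∣ p ∣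
x∉p⇒∣p∪⁅x⁆∣≡1+∣p∣ {p = p} {x} x∉p =
  trans (x∈p⇒∣p∣≡1+∣p-x∣ (x∈p∪⁅x⁆ x p)) (cong (suc ∘ ∣_∣) (⊆-antisym ⊆p p⊆))
  where
  ⊆p : (p ∪ ⁅ x ⁆) - x ⊆ p
  ⊆p y∈ with x∈p∪q⁻ p ⁅ x ⁆ (p-x⊆p (p ∪ ⁅ x ⁆) x y∈)
  ... | inj₁ y∈p = y∈p
  ... | inj₂ y∈x = contradiction (x∈⁅y⁆⇒x≡y x y∈x) (x∈p-y⇒x≢y (p ∪ ⁅ x ⁆) y∈)
  p⊆ : p ⊆ (p ∪ ⁅ x ⁆) - x
  p⊆ = p⊆q∧x∉p⇒p⊆q-x (p⊆p∪q ⁅ x ⁆) x∉p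

x∈p⇒0<∣p∣ : ∀ {p : Subset n} {x} → x ∈ p → 0 < ∣ p ∣
x∈p⇒0<∣p∣ x∈p = ≤-<-trans z≤n (x∈p⇒∣p-x∣<∣p∣ x∈p)

0<∣p∣⇒Nonempty : ∀ (p : Subset n) → 0 < ∣ p ∣ → Nonempty p
0<∣p∣⇒Nonempty {n} p 0<∣p∣ with nonempty? p
... | yes ne = ne
... | no ¬ne = contradiction (trans (cong ∣_∣ (Empty-unique ¬ne)) (∣⊥∣≡0 n)) (λ eq → <-irrefl (sym eq) 0<∣p∣)

-- One set D is chosen for each element of X while running through all of `Fin n`; applied to
-- circuits, this produces the list that `Cycle` asks for.
⋃-cover : ∀ {P : Pred (Subset n) 0ℓ} {X} →
          (∀ {x} → x ∈ X → ∃ λ D → P D × D ⊆ X × x ∈ D) → ∃ λ Ds → All P Ds × X ≡ ⋃ Ds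
⋃-cover {n} {P} {X} cover =
  let Ds , PDs , Ds⊆X , X⊆Ds = go (allFin n) in
  Ds , PDs , ⊆-antisym (X⊆Ds (∈-allFin _)) Ds⊆X
  where
  go : ∀ xs → ∃ λ Ds → All P Ds × ⋃ Ds ⊆ X × (∀ {x} → x ∈ₗ xs → x ∈ X → x ∈ ⋃ Ds)
  go []       = [] , [] , ⊆-min X , λ ()
  go (y ∷ xs) with go xs | y ∈? X
  ... | Ds , PDs , Ds⊆X , X⊆Ds | no y∉X = Ds , PDs , Ds⊆X , λ where
    (here refl) y∈X → contradiction y∈X y∉X
    (there x∈)      → X⊆Ds x∈
  ... | Ds , PDs , Ds⊆X , X⊆Ds | yes y∈X =
    let D , PD , D⊆X , y∈D = cover y∈X in
    D ∷ Ds , PD ∷ PDs , ∪-lub D⊆X Ds⊆X , λ where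
      (here refl) _   → p⊆p∪q (⋃ Ds) y∈D
      (there x∈)  x∈X → q⊆p∪q D (⋃ Ds) (X⊆Ds x∈ x∈X)

∈-⋃⁻ : ∀ {P : Pred (Subset n) 0ℓ} {Ds x} → All P Ds → x ∈ ⋃ Ds →
       ∃ λ D → P D × D ⊆ ⋃ Ds × x ∈ D
∈-⋃⁻ []                         x∈ = contradiction x∈ ∉⊥
∈-⋃⁻ {Ds = D ∷ Ds} (PD ∷ PDs) x∈ with x∈p∪q⁻ D (⋃ Ds) x∈
... | inj₁ x∈D = D , PD , p⊆p∪q (⋃ Ds) , x∈D
... | inj₂ x∈Ds =
  let D′ , PD′ , D′⊆ , x∈D′ = ∈-⋃⁻ PDs x∈Ds in D′ , PD′ , q⊆p∪q D (⋃ Ds) ∘ D′⊆ , x∈D′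

-- Ensures that every independent set enters the list over which `rank` takes its maximum.
∈-subsets : ∀ (p : Subset n) → p ∈ₗ subsets n
∈-subsets []            = here refl
∈-subsets (outside ∷ p) = ∈-++⁺ˡ (∈-map⁺ (outside ∷_) (∈-subsets p))
∈-subsets (inside  ∷ p) = ∈-++⁺ʳ _ (∈-map⁺ (inside ∷_) (∈-subsets p))

-- Bases, circuits and cycles of a matroid.

module _ (M : Matroid n) where

  ∣indep∣≤rank : ∀ {I} → Indep M I → ∣ I ∣ ≤ rank M
  ∣indep∣≤rank {I} iI = All.lookup (xs≤max 0 _)
    (∈-map⁺ ∣_∣ (∈-filter⁺ (indep? M) (∈-subsets I) iI))

  ∃basis : ∃ λ B → Indep M B × ∣ B ∣ ≡ rank M
  ∃basis with argmax-sel id 0 (List.map ∣_∣ (List.filter (indep? M) (subsets n)))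
  -- The maximum may be its default value 0; the empty set attains it.
  ... | inj₁ rank≡0 = ⊥ , indep-⊥ M , trans (∣⊥∣≡0 n) (sym rank≡0)
  ... | inj₂ rank∈ with ∈-map⁻ ∣_∣ rank∈
  ...   | B , B∈ , rank≡∣B∣ = B , proj₂ (∈-filter⁻ (indep? M) {xs = subsets n} B∈) , sym rank≡∣B∣

  -- Iterates `augment`, with d counting the elements still missing. The bound `K ⊆ I ∪ J` records
  -- that all new elements come from J; exchange in a contraction relies on it.
  augment-to : ∀ {I J} → Indep M I → Indep M J → ∣ I ∣ ≤ ∣ J ∣ →
               ∃ λ K → Indep M K × I ⊆ K × K ⊆ I ∪ J × ∣ K ∣ ≡ ∣ J ∣
  augment-to {I} {J} iI iJ I≤J = go (∣ J ∣ ∸ ∣ I ∣) iI id (p⊆p∪q J) (m∸n+n≡m I≤J)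
    where
    go : ∀ d {K} → Indep M K → I ⊆ K → K ⊆ I ∪ J → d + ∣ K ∣ ≡ ∣ J ∣ →
         ∃ λ K → Indep M K × I ⊆ K × K ⊆ I ∪ J × ∣ K ∣ ≡ ∣ J ∣
    go zero    iK I⊆K K⊆ eq = _ , iK , I⊆K , K⊆ , eq
    go (suc d) {K} iK I⊆K K⊆ eq =
      let x , x∈J , x∉K , iKx = augment M iK iJ (subst (∣ K ∣ <_) eq (s≤s (m≤n+m ∣ K ∣ d)))
      in  go d iKx (p⊆p∪q ⁅ x ⁆ ∘ I⊆K) (∪-lub K⊆ (⁅x⁆⊆ (q⊆p∪q I J x∈J)))
             (trans (cong (d +_) (x∉p⇒∣p∪⁅x⁆∣≡1+∣p∣ x∉K)) (trans (+-suc d ∣ K ∣) eq))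

  -- x lies in the closure of X ∖ {x}; a cycle is exactly a set X ⊆ E all of whose elements do.
  InClosure : Subset n → Fin n → Set
  InClosure X x = ∃ λ I → I ⊆ X × Indep M I × ¬ Indep M (I ∪ ⁅ x ⁆)

  -- Elements are removed as long as the rest stays dependent. When every single removal gives an
  -- independent set, so does every proper subset, by heredity.
  circuit-⊆ : ∀ {X} → Dependent M X → ∃ λ D → Circuit M D × D ⊆ X
  circuit-⊆ {X} dep = go dep (<-wellFounded ∣ X ∣)
    where
    go : ∀ {X} → Dependent M X → Acc _<_ ∣ X ∣ → ∃ λ D → Circuit M D × D ⊆ X
    go {X} (X⊆E , ¬iX) (acc rec) with any? (λ x → (x ∈? X) ×-dec ¬? (indep? M (X - x)))
    ... | yes (x , x∈X , ¬iX-x) =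
      let D , cD , D⊆ = go (X⊆E ∘ p-x⊆p X x , ¬iX-x) (rec (x∈p⇒∣p-x∣<∣p∣ x∈X))
      in  D , cD , p-x⊆p X x ∘ D⊆
    ... | no minimal = X , ((X⊆E , ¬iX) , λ (Y⊆X , x , x∈X , x∉Y) →
      indep-⊆ M (p⊆q∧x∉p⇒p⊆q-x Y⊆X x∉Y)
        (decidable-stable (indep? M (X - x)) (λ ¬i → minimal (x , x∈X , ¬i)))) , id

  -- A circuit inside `I ∪ ⁅ x ⁆` must use x, since otherwise it would lie in the independent set I.
  inClosure⇒circuit : ∀ {X x} → X ⊆ E M → x ∈ X → InClosure X x →
                      ∃ λ D → Circuit M D × D ⊆ X × x ∈ D
  inClosure⇒circuit {X} {x} X⊆E x∈X (I , I⊆X , iI , ¬iIx)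
    with circuit-⊆ ((X⊆E ∘ ∪-lub I⊆X (⁅x⁆⊆ x∈X)) , ¬iIx)
  ... | D , cD@((_ , ¬iD) , _) , D⊆Ix = D , cD , ∪-lub I⊆X (⁅x⁆⊆ x∈X) ∘ D⊆Ix ,
    decidable-stable (x ∈? D) λ x∉D → ¬iD (indep-⊆ M (D⊆I x∉D) iI)
    where
    D⊆I : x ∉ D → D ⊆ I
    D⊆I x∉D y∈D with x∈p∪q⁻ I ⁅ x ⁆ (D⊆Ix y∈D)
    ... | inj₁ y∈I = y∈I
    ... | inj₂ y∈x = contradiction (subst (_∈ D) (x∈⁅y⁆⇒x≡y x y∈x) y∈D) x∉D

  cycle⁺ : ∀ {X} → X ⊆ E M → (∀ {x} → x ∈ X → InClosure X x) → Cycle M X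
  cycle⁺ X⊆E closed = ⋃-cover λ x∈X → inClosure⇒circuit X⊆E x∈X (closed x∈X)

  cycle⊆E : ∀ {X} → Cycle M X → X ⊆ E M
  cycle⊆E (_ , circuits , refl) x∈X with ∈-⋃⁻ circuits x∈X
  ... | D , ((D⊆E , _) , _) , _ , x∈D = D⊆E x∈D

  -- For a circuit D of the union through x, the witness is `D - x`: independent by minimality, and
  -- dependent again once x is put back.
  cycle⁻ : ∀ {X x} → Cycle M X → x ∈ X → InClosure X x
  cycle⁻ {x = x} (_ , circuits , refl) x∈X with ∈-⋃⁻ circuits x∈X
  ... | D , ((_ , ¬iD) , minimal) , D⊆X , x∈D =
    D - x , D⊆X ∘ p-x⊆p D x , minimal (x∈p⇒p-x⊂p x∈D) , ¬iD ∘ indep-⊆ M (p⊆p-x∪⁅x⁆ D x)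

-- Deletion and contraction of one element.

∣E-e∣∸r≡pred[∣E∣∸r] : ∀ {p : Subset n} {e} r → e ∈ p → ∣ p - e ∣ ∸ r ≡ pred (∣ p ∣ ∸ r)
∣E-e∣∸r≡pred[∣E∣∸r] {p = p} {e} r e∈p = sym (begin
  pred (∣ p ∣ ∸ r)             ≡⟨ pred[m∸n]≡m∸[1+n] ∣ p ∣ r ⟩
  ∣ p ∣ ∸ suc r                ≡⟨ cong (_∸ suc r) (x∈p⇒∣p∣≡1+∣p-x∣ e∈p) ⟩
  suc ∣ p - e ∣ ∸ suc r        ∎)
  where open ≡-Reasoning

-- An independent I ∌ e with I ∪ {e} dependent extends to a basis avoiding e.
rank-∖ : ∀ (M : Matroid n) {X e} → InClosure M X e → rank (M ∖ e) ≡ rank M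
rank-∖ M {X} {e} (I , _ , iI , ¬iIe) = ≤-antisym
  (let B , (_ , iB) , ∣B∣ = ∃basis (M ∖ e) in subst (_≤ rank M) ∣B∣ (∣indep∣≤rank M iB))
  (let B , iB , ∣B∣ = ∃basis M
       K , iK , I⊆K , _ , ∣K∣ = augment-to M iI iB (subst (∣ I ∣ ≤_) (sym ∣B∣) (∣indep∣≤rank M iI))
   in  subst (_≤ rank (M ∖ e)) (trans ∣K∣ ∣B∣)
         (∣indep∣≤rank (M ∖ e) ((λ e∈K → ¬iIe (indep-⊆ M (∪-lub I⊆K (⁅x⁆⊆ e∈K)) iK)) , iK)))

corank-∖ : ∀ (M : Matroid n) {X e} → e ∈ E M → InClosure M X e → corank (M ∖ e) ≡ pred (corank M)
corank-∖ M e∈E cl = trans (∣E-e∣∸r≡pred[∣E∣∸r] (rank (M ∖ _)) e∈E) (cong (λ r → pred (∣ E M ∣ ∸ r)) (rank-∖ M cl))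

-- The closure witnesses lie inside X, so they avoid e and survive the deletion.
cycle-∖ : ∀ (M : Matroid n) {X e} → e ∉ X → Cycle M X → Cycle (M ∖ e) X
cycle-∖ M e∉X cyc = cycle⁺ (M ∖ _) (p⊆q∧x∉p⇒p⊆q-x (cycle⊆E M cyc) e∉X) λ x∈X →
  let I , I⊆X , iI , ¬iIx = cycle⁻ M cyc x∈X
  in  I , I⊆X , (e∉X ∘ I⊆X , iI) , ¬iIx ∘ proj₂

dependent-∖ : ∀ (M : Matroid n) {X e} → e ∉ X → Dependent M X → Dependent (M ∖ e) X
dependent-∖ M e∉X (X⊆E , ¬iX) = p⊆q∧x∉p⇒p⊆q-x X⊆E e∉X , ¬iX ∘ proj₂

-- A basis of M / e together with e is independent in M. Conversely, ⁅ e ⁆ extends to a basis of M,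
-- and dropping e from it leaves an independent set of M / e.
rank-contract : ∀ (M : Matroid n) {e} (nl : NonLoop M e) → suc (rank (contract M e nl)) ≡ rank M
rank-contract M {e} nl = ≤-antisym
  (let B , (e∉B , iBe) , ∣B∣ = ∃basis M/e
   in  subst (_≤ rank M) (trans (x∉p⇒∣p∪⁅x⁆∣≡1+∣p∣ e∉B) (cong suc ∣B∣)) (∣indep∣≤rank M iBe))
  (let B , iB , ∣B∣ = ∃basis M
       K , iK , e⊆K , _ , ∣K∣ = augment-to M ie iB (subst (∣ ⁅ e ⁆ ∣ ≤_) (sym ∣B∣) (∣indep∣≤rank M ie))
       e∈K = e⊆K (x∈⁅x⁆ e)
   in  subst (_≤ suc (rank M/e)) (trans (sym (x∈p⇒∣p∣≡1+∣p-x∣ e∈K)) (trans ∣K∣ ∣B∣))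
         (s≤s (∣indep∣≤rank M/e (x∉p-x K e , indep-⊆ M (p-x∪⁅x⁆⊆p e∈K) iK))))
  where
  M/e = contract M e nl
  ie  = nonLoop⇒indep M nl

-- Ground set and rank both lose one; a common `suc` cancels under `_∸_` by computation.
corank-contract : ∀ (M : Matroid n) {e} (nl : NonLoop M e) → corank (contract M e nl) ≡ corank M
corank-contract M {e} nl@(e∈E , _) = begin
  ∣ E M - e ∣ ∸ rank M/e            ≡⟨⟩
  suc ∣ E M - e ∣ ∸ suc (rank M/e)  ≡⟨ cong₂ _∸_ (sym (x∈p⇒∣p∣≡1+∣p-x∣ e∈E)) (rank-contract M nl) ⟩
  ∣ E M ∣ ∸ rank M                  ∎
  where
  open ≡-Reasoning
  M/e = contract M e nl

-- K is a basis of J ∪ {e} through e, so it spans x because J does.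
spanning-through : ∀ (M : Matroid n) {e x J} → NonLoop M e → x ≢ e →
  Indep M J → ¬ Indep M (J ∪ ⁅ x ⁆) →
  ∃ λ K → e ∈ K × K ⊆ J ∪ ⁅ e ⁆ × Indep M K × ¬ Indep M (K ∪ ⁅ x ⁆)
spanning-through M {e} {x} {J} nl x≢e iJ ¬iJx with indep? M (J ∪ ⁅ e ⁆)
... | yes iJe = J ∪ ⁅ e ⁆ , x∈p∪⁅x⁆ e J , id , iJe ,
                ¬iJx ∘ indep-⊆ M (∪-monoˡ-⊆ ⁅ x ⁆ (p⊆p∪q ⁅ e ⁆))
... | no ¬iJe = K , e⊆K (x∈⁅x⁆ e) , subst (K ⊆_) (∪-comm ⁅ e ⁆ J) K⊆ , iK , ¬iKx
  where
  ie = nonLoop⇒indep M nl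

  ∣e∣≤∣J∣ : ∣ ⁅ e ⁆ ∣ ≤ ∣ J ∣
  ∣e∣≤∣J∣ with ∣ ⁅ e ⁆ ∣ ≤? ∣ J ∣
  ... | yes ≤J = ≤J
  -- If J were smaller than ⁅ e ⁆, augmentation could only add e to J, which `¬iJe` forbids.
  ... | no  ≰J with augment M iJ ie (≰⇒> ≰J)
  ...   | y , y∈e , _ , iJy =
    contradiction (subst (λ y → Indep M (J ∪ ⁅ y ⁆)) (x∈⁅y⁆⇒x≡y e y∈e) iJy) ¬iJe

  extension = augment-to M ie iJ ∣e∣≤∣J∣
  K   = proj₁ extension
  iK  = proj₁ (proj₂ extension)
  e⊆K = proj₁ (proj₂ (proj₂ extension))
  K⊆  = proj₁ (proj₂ (proj₂ (proj₂ extension)))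
  ∣K∣ = proj₂ (proj₂ (proj₂ (proj₂ extension)))

  ¬iKx : ¬ Indep M (K ∪ ⁅ x ⁆)
  ¬iKx iKx with x ∈? K
  ... | yes x∈K = case x∈p∪q⁻ ⁅ e ⁆ J (K⊆ x∈K) of λ where
    (inj₁ x∈e) → x≢e (x∈⁅y⁆⇒x≡y e x∈e)
    (inj₂ x∈J) → ¬iJx (indep-⊆ M (∪-lub id (⁅x⁆⊆ x∈J)) iJ)
  -- As K has the size of J, an independent `K ∪ ⁅ x ⁆` would augment J by some y. Outside J this
  -- set offers only x and e, and J stays independent with neither.
  ... | no x∉K with augment M iJ iKx (≤-reflexive (sym (trans (x∉p⇒∣p∪⁅x⁆∣≡1+∣p∣ x∉K) (cong suc ∣K∣))))
  ...   | y , y∈Kx , y∉J , iJy with x∈p∪q⁻ K ⁅ x ⁆ y∈Kx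
  ...     | inj₂ y∈x = ¬iJx (subst (λ y → Indep M (J ∪ ⁅ y ⁆)) (x∈⁅y⁆⇒x≡y x y∈x) iJy)
  ...     | inj₁ y∈K with x∈p∪q⁻ ⁅ e ⁆ J (K⊆ y∈K)
  ...       | inj₁ y∈e = ¬iJe (subst (λ y → Indep M (J ∪ ⁅ y ⁆)) (x∈⁅y⁆⇒x≡y e y∈e) iJy)
  ...       | inj₂ y∈J = y∉J y∈J

-- A witness J for x in M is exchanged for a K through e that still spans x; then `K - e` is a
-- witness in M / e, because contraction puts e back before testing independence.
cycle-contract : ∀ (M : Matroid n) {X e} (nl : NonLoop M e) → Cycle M X → Cycle (contract M e nl) (X - e)
cycle-contract M {X} {e} nl cyc = cycle⁺ (contract M e nl)
  (p⊆q∧x∉p⇒p⊆q-x (cycle⊆E M cyc ∘ p-x⊆p X e) (x∉p-x X e))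
  λ {x} x∈X-e →
    let J , J⊆X , iJ , ¬iJx = cycle⁻ M cyc (p-x⊆p X e x∈X-e)
        K , e∈K , K⊆Je , iK , ¬iKx = spanning-through M nl (x∈p-y⇒x≢y X x∈X-e) iJ ¬iJx
    in  K - e
      , p⊆q∧x∉p⇒p⊆q-x (λ y∈ → [ J⊆X , (λ y∈e → contradiction (x∈⁅y⁆⇒x≡y e y∈e) (x∈p-y⇒x≢y K y∈)) ]′
                               (x∈p∪q⁻ J ⁅ e ⁆ (K⊆Je (p-x⊆p K e y∈)))) (x∉p-x K e)
      , (x∉p-x K e , indep-⊆ M (p-x∪⁅x⁆⊆p e∈K) iK)
      , λ (_ , i) → ¬iKx (indep-⊆ M
          (∪-lub (∪-monoˡ-⊆ ⁅ e ⁆ (p⊆p∪q ⁅ x ⁆) ∘ p⊆p-x∪⁅x⁆ K e)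
                 (p⊆p∪q ⁅ e ⁆ ∘ q⊆p∪q (K - e) ⁅ x ⁆)) i)

dependent-contract : ∀ (M : Matroid n) {X e} (nl : NonLoop M e) →
                     Dependent M X → Dependent (contract M e nl) (X - e)
dependent-contract M {X} {e} nl (X⊆E , ¬iX) =
  p⊆q∧x∉p⇒p⊆q-x (X⊆E ∘ p-x⊆p X e) (x∉p-x X e) ,
  ¬iX ∘ indep-⊆ M (p⊆p-x∪⁅x⁆ X e) ∘ proj₂

-- Unique unions of subfamilies.

module _ (A : Vec (Subset n) g) {σ : Subset g} {x : Fin n} where

  ∈-uniqueUnion⁺ : InExactlyOne A σ x → x ∈ uniqueUnion A σ
  ∈-uniqueUnion⁺ h = lookup⇒[]= x _ (trans (lookup∘tabulate _ x) (dec-true (inExactlyOne? A σ x) h))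

  ∈-uniqueUnion⁻ : x ∈ uniqueUnion A σ → InExactlyOne A σ x
  ∈-uniqueUnion⁻ x∈ with inExactlyOne? A σ x | trans (sym (lookup∘tabulate _ x)) ([]=⇒lookup x∈)
  ... | yes h | _  = h
  ... | no  _ | ()

-- An x other than e lies in exactly the same members before and after the removal, so its
-- uniqueness is unaffected.
uniqueUnion-map-remove : ∀ (A : Vec (Subset n) g) σ e → uniqueUnion (map (_- e) A) σ ≡ uniqueUnion A σ - e
uniqueUnion-map-remove A σ e = ⊆-antisym to from
  where
  to : uniqueUnion (map (_- e) A) σ ⊆ uniqueUnion A σ - e
  to {x} x∈ with ∈-uniqueUnion⁻ (map (_- e) A) x∈
  ... | j , (j∈σ , x∈Aj-e) , unique =
    x∈p∧x≢y⇒x∈p-y (∈-uniqueUnion⁺ A (j , (j∈σ , p-x⊆p (lookup A j) e x∈′) , λ {k} (k∈σ , x∈Ak) →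
      unique (k∈σ , subst (x ∈_) (sym (lookup-map k (_- e) A)) (x∈p∧x≢y⇒x∈p-y x∈Ak x≢e)))) x≢e
    where
    x∈′ : x ∈ lookup A j - e
    x∈′ = subst (x ∈_) (lookup-map j (_- e) A) x∈Aj-e
    x≢e = x∈p-y⇒x≢y (lookup A j) x∈′
  from : uniqueUnion A σ - e ⊆ uniqueUnion (map (_- e) A) σ
  from {x} x∈ with ∈-uniqueUnion⁻ A (p-x⊆p (uniqueUnion A σ) e x∈)
  ... | j , (j∈σ , x∈Aj) , unique = ∈-uniqueUnion⁺ (map (_- e) A)
    (j , (j∈σ , subst (x ∈_) (sym (lookup-map j (_- e) A)) (x∈p∧x≢y⇒x∈p-y x∈Aj (x∈p-y⇒x≢y (uniqueUnion A σ) x∈)))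
       , λ {k} (k∈σ , x∈Ak) → unique (k∈σ , p-x⊆p (lookup A k) e (subst (x ∈_) (lookup-map k (_- e) A) x∈Ak)))

lookup-removeAt : ∀ {a} {A : Set a} (xs : Vec A (suc k)) i j →
                  lookup (removeAt xs i) j ≡ lookup xs (punchIn i j)
lookup-removeAt xs i j = trans (sym (insertAt-punchIn (removeAt xs i) i (lookup xs i) j))
  (cong (λ ys → lookup ys (punchIn i j)) (insertAt-removeAt xs i))

module _ (σ : Subset g) (i : Fin (suc g)) where

  i∉insertAt-outside : i ∉ insertAt σ i outside
  i∉insertAt-outside i∈ with trans (sym (insertAt-lookup σ i outside)) ([]=⇒lookup i∈)
  ... | ()

  punchIn∈insertAt⁺ : ∀ {b j} → j ∈ σ → punchIn i j ∈ insertAt σ i b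
  punchIn∈insertAt⁺ {b} {j} j∈σ = lookup⇒[]= _ _ (trans (insertAt-punchIn σ i b j) ([]=⇒lookup j∈σ))

  ∈-insertAt-outside⁻ : ∀ {j} → j ∈ insertAt σ i outside → ∃ λ k → k ∈ σ × j ≡ punchIn i k
  ∈-insertAt-outside⁻ {j} j∈ = punchOut i≢j , lookup⇒[]= _ _ (begin
    lookup σ (punchOut i≢j)              ≡⟨ insertAt-punchIn σ i outside _ ⟨
    lookup τ (punchIn i (punchOut i≢j))  ≡⟨ cong (lookup τ) (punchIn-punchOut i≢j) ⟩
    lookup τ j                           ≡⟨ []=⇒lookup j∈ ⟩
    inside                               ∎) , sym (punchIn-punchOut i≢j)
    where
    open ≡-Reasoning
    τ = insertAt σ i outside
    i≢j : i ≢ j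
    i≢j refl = i∉insertAt-outside j∈

-- `punchIn i` matches σ with an index set avoiding i. Conditions on the shortened family thereby
-- become conditions on the full family at such index sets.
uniqueUnion-removeAt : ∀ (A : Vec (Subset n) (suc g)) i σ →
                       uniqueUnion (removeAt A i) σ ≡ uniqueUnion A (insertAt σ i outside)
uniqueUnion-removeAt A i σ = ⊆-antisym to from
  where
  to : uniqueUnion (removeAt A i) σ ⊆ uniqueUnion A (insertAt σ i outside)
  to {x} x∈ with ∈-uniqueUnion⁻ (removeAt A i) x∈
  ... | j , (j∈σ , x∈Aj) , unique = ∈-uniqueUnion⁺ A
    (punchIn i j , (punchIn∈insertAt⁺ σ i j∈σ , subst (x ∈_) (lookup-removeAt A i j) x∈Aj) , unique′)
    where
    unique′ : ∀ {l} → l ∈ insertAt σ i outside × x ∈ lookup A l → punchIn i j ≡ l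
    unique′ (l∈ , x∈Al) with ∈-insertAt-outside⁻ σ i l∈
    ... | k , k∈σ , refl = cong (punchIn i) (unique (k∈σ , subst (x ∈_) (sym (lookup-removeAt A i k)) x∈Al))
  from : uniqueUnion A (insertAt σ i outside) ⊆ uniqueUnion (removeAt A i) σ
  from {x} x∈ with ∈-uniqueUnion⁻ A x∈
  ... | j , (j∈ , x∈Aj) , unique with ∈-insertAt-outside⁻ σ i j∈
  ...   | k , k∈σ , refl = ∈-uniqueUnion⁺ (removeAt A i)
    (k , (k∈σ , subst (x ∈_) (sym (lookup-removeAt A i k)) x∈Aj) , λ {l} (l∈σ , x∈Al) →
      punchIn-injective i k l
        (unique (punchIn∈insertAt⁺ σ i l∈σ , subst (x ∈_) (lookup-removeAt A i l) x∈Al)))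

insertAt-outside-nonempty : ∀ {σ : Subset g} i → Nonempty σ → Nonempty (insertAt σ i outside)
insertAt-outside-nonempty {σ = σ} i (j , j∈σ) = punchIn i j , punchIn∈insertAt⁺ σ i j∈σ

∉⇒≡insertAt-outside : ∀ {σ : Subset (suc g)} {i} → i ∉ σ → σ ≡ insertAt (removeAt σ i) i outside
∉⇒≡insertAt-outside {σ = σ} {i} i∉σ = trans (sym (insertAt-removeAt σ i))
  (cong (insertAt (removeAt σ i) i) (¬-not (i∉σ ∘ lookup⇒[]= i σ)))

-- Elements of a single cycle, and cycle systems of minors.

OnlyIn : Vec (Subset n) g → Fin g → Fin n → Set
OnlyIn A i e = e ∈ lookup A i × (∀ {j} → e ∈ lookup A j → j ≡ i)

-- In `⊤` all indices compete, so uniqueness there gives a condition free of σ, usable for every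
-- unique union.
∈-uniqueUnion-⊤⇒OnlyIn : ∀ (A : Vec (Subset n) g) {i e} →
                          e ∈ uniqueUnion A ⊤ → e ∈ lookup A i → OnlyIn A i e
∈-uniqueUnion-⊤⇒OnlyIn A e∈ e∈Ai with ∈-uniqueUnion⁻ A e∈
... | k , _ , unique = e∈Ai , λ e∈Aj → trans (sym (unique (∈⊤ , e∈Aj))) (unique (∈⊤ , e∈Ai))

module _ (A : Vec (Subset n) g) {i : Fin g} {e : Fin n} (only : OnlyIn A i e) where

  onlyIn⇒∈∩uniqueUnion : ∀ {σ} → i ∈ σ → e ∈ lookup A i ∩ uniqueUnion A σ
  onlyIn⇒∈∩uniqueUnion i∈σ = x∈p∩q⁺
    (proj₁ only , ∈-uniqueUnion⁺ A (i , (i∈σ , proj₁ only) , sym ∘ proj₂ only ∘ proj₂))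

  onlyIn⇒∉uniqueUnion : ∀ {σ} → i ∉ σ → e ∉ uniqueUnion A σ
  onlyIn⇒∉uniqueUnion {σ} i∉σ e∈ with ∈-uniqueUnion⁻ A e∈
  ... | j , (j∈σ , e∈Aj) , _ = i∉σ (subst (_∈ σ) (proj₂ only e∈Aj) j∈σ)

-- The corank falls by one because e lies in the cycle `C_i`. The other cycles, and the unique
-- unions of index sets avoiding i, miss e.
isCycleSystem-∖ : ∀ {M : Matroid n} {C : Vec (Subset n) (suc g)} {i e} →
                  IsCycleSystem M C → OnlyIn C i e → IsCycleSystem (M ∖ e) (removeAt C i)
isCycleSystem-∖ {M = M} {C} {i} {e} cs only = record
  { size      = sym (trans (corank-∖ M (cycle⊆E M (cycle cs i) (proj₁ only))
                              (cycle⁻ M (cycle cs i) (proj₁ only)))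
                           (cong pred (sym (size cs))))
  ; cycle     = λ j → subst (Cycle (M ∖ e)) (sym (lookup-removeAt C i j))
                        (cycle-∖ M (punchInᵢ≢i i j ∘ proj₂ only) (cycle cs (punchIn i j)))
  ; dependent = λ σ ne → subst (Dependent (M ∖ e)) (sym (uniqueUnion-removeAt C i σ))
                  (dependent-∖ M (onlyIn⇒∉uniqueUnion C only (i∉insertAt-outside σ i))
                    (dependent cs _ (insertAt-outside-nonempty i ne)))
  }

isCycleSystem-contract : ∀ {M : Matroid n} {C : Vec (Subset n) g} {e} →
  IsCycleSystem M C → (nl : NonLoop M e) → IsCycleSystem (contract M e nl) (map (_- e) C)
isCycleSystem-contract {M = M} {C} {e} cs nl = record
  { size      = trans (size cs) (sym (corank-contract M nl))
  ; cycle     = λ j → subst (Cycle (contract M e nl)) (sym (lookup-map j (_- e) C))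
                        (cycle-contract M nl (cycle cs j))
  ; dependent = λ σ ne → subst (Dependent (contract M e nl)) (sym (uniqueUnion-map-remove C σ e))
                  (dependent-contract M nl (dependent cs σ ne))
  }

-- Induction on g: delete an element f ≠ e of the unique union of the whole family
-- and drop the cycle containing f, until the corank is 0 while e is still a loop.
loop-uniqueUnion : ∀ {g} {M : Matroid n} {C : Vec (Subset n) g} {e} →
  IsCycleSystem M C → Dependent M ⁅ e ⁆ → ¬ (∀ σ → Nonempty σ → Nonempty (uniqueUnion C σ - e))
loop-uniqueUnion {g = zero} {M} {e = e} cs (e⊆E , ¬ie) _ =
  -- Corank 0 gives `∣ E M ∣ ≤ rank M`, whereas a basis avoids e and is therefore smaller than
  -- `E M`.
  let B , iB , ∣B∣ = ∃basis M
      e∈E = e⊆E (x∈⁅x⁆ e)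
      e∉B = λ e∈B → ¬ie (indep-⊆ M (⁅x⁆⊆ e∈B) iB)
  in  ≤⇒≯ (m∸n≡0⇒m≤n (sym (size cs)))
        (subst (_< ∣ E M ∣) ∣B∣
          (≤-<-trans (p⊆q⇒∣p∣≤∣q∣ (p⊆q∧x∉p⇒p⊆q-x (indep⇒⊆E M iB) e∉B)) (x∈p⇒∣p-x∣<∣p∣ e∈E)))
loop-uniqueUnion {g = suc _} {M} {C} {e} cs dep nonempty
  with f , f∈ ← nonempty ⊤ (zero , ∈⊤)
  with j , (_ , f∈Cj) , _ ← ∈-uniqueUnion⁻ C (p-x⊆p (uniqueUnion C ⊤) e f∈) =
  loop-uniqueUnion
    (isCycleSystem-∖ cs (∈-uniqueUnion-⊤⇒OnlyIn C (p-x⊆p (uniqueUnion C ⊤) e f∈) f∈Cj))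
    (dependent-∖ M (x≢y⇒x∉⁅y⁆ (x∈p-y⇒x≢y (uniqueUnion C ⊤) f∈)) dep)
    λ σ ne → subst (λ U → Nonempty (U - e)) (sym (uniqueUnion-removeAt C j σ))
               (nonempty _ (insertAt-outside-nonempty j ne))

-- Coparking functions under the two maps.

module _ (C : Vec (Subset n) (suc g)) {i : Fin (suc g)} (a : Vec ℕ g) where

  P*-insertAt-0⁺ : ∀ {e} → OnlyIn C i e → P* (removeAt C i) a → P* C (insertAt a i 0)
  P*-insertAt-0⁺ only a∈P* σ (k , k∈σ) with i ∈? σ
  ... | yes i∈σ = i , i∈σ ,
    subst (_< _) (sym (insertAt-lookup a i 0)) (x∈p⇒0<∣p∣ (onlyIn⇒∈∩uniqueUnion C only i∈σ))
  -- Now σ is `insertAt τ i outside` for τ = `removeAt σ i`; the member k of σ shows that τ is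
  -- nonempty, so the assumption on a can be applied to τ.
  ... | no i∉σ rewrite ∉⇒≡insertAt-outside i∉σ
    with k′ , k′∈τ , _ ← ∈-insertAt-outside⁻ (removeAt σ i) i k∈σ
    with j , j∈τ , aj< ← a∈P* (removeAt σ i) (k′ , k′∈τ)
    rewrite lookup-removeAt C i j | uniqueUnion-removeAt C i (removeAt σ i) =
    punchIn i j , punchIn∈insertAt⁺ (removeAt σ i) i j∈τ ,
    subst (_< _) (sym (insertAt-punchIn a i 0 j)) aj<

  -- Only index sets avoiding i are tested, so the index found is some `punchIn i k`, where the
  -- inserted vector agrees with a at k.
  P*-insertAt⁻ : ∀ {v} → P* C (insertAt a i v) → P* (removeAt C i) a
  P*-insertAt⁻ {v} a∈P* σ ne
    with j , j∈ , aj< ← a∈P* (insertAt σ i outside) (insertAt-outside-nonempty i ne)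
    with k , k∈σ , refl ← ∈-insertAt-outside⁻ σ i j∈
    rewrite insertAt-punchIn a i v k
          | sym (lookup-removeAt C i k)
          | sym (uniqueUnion-removeAt C i σ) = k , k∈σ , aj<

module _ (C : Vec (Subset n) g) {i : Fin g} {e : Fin n} (only : OnlyIn C i e) (a : Vec ℕ g) where

  private
    thresholds : ∀ σ j → ∣ lookup (map (_- e) C) j ∩ uniqueUnion (map (_- e) C) σ ∣
                       ≡ ∣ (lookup C j ∩ uniqueUnion C σ) - e ∣
    thresholds σ j rewrite lookup-map j (_- e) C | uniqueUnion-map-remove C σ e =
      cong ∣_∣ (⊆-antisym
        (λ x∈ → let x∈p , x∈q = x∈p∩q⁻ (lookup C j - e) _ x∈ in
          x∈p∧x≢y⇒x∈p-y (x∈p∩q⁺ (p-x⊆p (lookup C j) e x∈p , p-x⊆p (uniqueUnion C σ) e x∈q))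
                        (x∈p-y⇒x≢y (lookup C j) x∈p))
        (λ x∈ → let x∈p , x∈q = x∈p∩q⁻ (lookup C j) _ (p-x⊆p _ e x∈)
                    x≢e = x∈p-y⇒x≢y (lookup C j ∩ uniqueUnion C σ) x∈ in
          x∈p∩q⁺ (x∈p∧x≢y⇒x∈p-y x∈p x≢e , x∈p∧x≢y⇒x∈p-y x∈q x≢e)))

    -- Both sides of the coparking inequality at i ∈ σ drop by one, and no other inequality changes.
    threshold-i : ∀ {σ} → i ∈ σ → ∣ lookup C i ∩ uniqueUnion C σ ∣
                                ≡ suc ∣ lookup (map (_- e) C) i ∩ uniqueUnion (map (_- e) C) σ ∣
    threshold-i {σ} i∈σ = trans (x∈p⇒∣p∣≡1+∣p-x∣ (onlyIn⇒∈∩uniqueUnion C only i∈σ))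
                                (cong suc (sym (thresholds σ i)))

    threshold-j : ∀ σ {j} → j ≢ i → ∣ lookup C j ∩ uniqueUnion C σ ∣
                                  ≡ ∣ lookup (map (_- e) C) j ∩ uniqueUnion (map (_- e) C) σ ∣
    threshold-j σ {j} j≢i = sym (trans (thresholds σ j) (cong ∣_∣
      (x∉p⇒p-x≡p (j≢i ∘ proj₂ only ∘ p∩q⊆p (lookup C j) (uniqueUnion C σ)))))

  P*-increment⁺ : P* (map (_- e) C) a → P* C (updateAt a i suc)
  P*-increment⁺ a∈P* σ ne with a∈P* σ ne
  ... | j , j∈σ , aj< with j ≟ᶠ i
  ...   | yes refl = j , j∈σ ,
    subst₂ _<_ (sym (lookup∘updateAt j a)) (sym (threshold-i j∈σ)) (s≤s aj<)
  ...   | no j≢i = j , j∈σ ,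
    subst₂ _<_ (sym (lookup∘updateAt′ j i j≢i a)) (sym (threshold-j σ j≢i)) aj<

  P*-increment⁻ : P* C (updateAt a i suc) → P* (map (_- e) C) a
  P*-increment⁻ a∈P* σ ne with a∈P* σ ne
  ... | j , j∈σ , aj< with j ≟ᶠ i
  ...   | yes refl = j , j∈σ , s<s⁻¹ (subst₂ _<_ (lookup∘updateAt j a) (threshold-i j∈σ) aj<)
  ...   | no j≢i = j , j∈σ , subst₂ _<_ (lookup∘updateAt′ j i j≢i a) (threshold-j σ j≢i) aj<

-- A natural number lies strictly below some threshold, so that threshold is positive and its
-- intersection inhabited.
P*⇒Nonempty-uniqueUnion : ∀ (C : Vec (Subset n) g) {a} → P* C a →
                          ∀ σ → Nonempty σ → Nonempty (uniqueUnion C σ)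
P*⇒Nonempty-uniqueUnion C a∈P* σ ne =
  let j , _ , aj< = a∈P* σ ne
      x , x∈ = 0<∣p∣⇒Nonempty _ (≤-<-trans z≤n aj<)
  in  x , p∩q⊆q (lookup C j) _ x∈

updateAt-suc∘pred : ∀ (b : Vec ℕ g) i → lookup b i > 0 → updateAt (updateAt b i pred) i suc ≡ b
updateAt-suc∘pred b i bi>0 = trans (updateAt-updateAt i b) (updateAt-id-local i b (suc-pred′ bi>0))
  where
  suc-pred′ : ∀ {m} → m > 0 → suc (pred m) ≡ m
  suc-pred′ (s≤s _) = refl

updateAt-pred∘suc : ∀ (a : Vec ℕ g) i → updateAt (updateAt a i suc) i pred ≡ a
updateAt-pred∘suc a i = trans (updateAt-updateAt i a) (updateAt-id i a)

insertAt-removeAt-≡ : ∀ {a} {A : Set a} (xs : Vec A (suc k)) i {v} → lookup xs i ≡ v →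
                      insertAt (removeAt xs i) i v ≡ xs
insertAt-removeAt-≡ xs i refl = insertAt-removeAt xs i

proposition4p4 : ∀ {n g : ℕ} (M : Matroid n) (C : Vec (Subset n) (suc g)) → IsCycleSystem M C →
    ∀ (i : Fin (suc g)) (e : Fin n) → e ∈ uniqueUnion C ⊤ ∩ lookup C i →
    let C′ = removeAt C i
        C″ = map (_- e) C
        insert-0  = λ (a : Vec ℕ g) → insertAt a i 0
        increment = λ (a : Vec ℕ (suc g)) → updateAt a i suc
    in
    ( IsCycleSystem (M ∖ e) C′
    × IsInjectiveMap insert-0 (P* C′) (P* C)
    × (Image insert-0 (P* C′) ≐ λ a → P* C a × lookup a i ≡ 0)
    × (Loop M e → IsBijectiveMap insert-0 (P* C′) (P* C)) )
    ×
    ( (nl : NonLoop M e) →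
        IsCycleSystem (contract M e nl) C″
      × IsInjectiveMap increment (P* C″) (P* C)
      × (Image increment (P* C″) ≐ λ a → P* C a × lookup a i > 0) )
proposition4p4 {g = g} M C cs i e e∈ =
  ( isCycleSystem-∖ cs only
  , insert-0-injective
  , ( (λ { (a , a∈P* , refl) → P*-insertAt-0⁺ C a only a∈P* , insertAt-lookup a i 0 })
    , λ {b} (b∈P* , bi≡0) → insert-0-image {b} b∈P* bi≡0 )
  , λ loop → record
      { isInjectiveMap = insert-0-injective
      ; surjective     = λ {b} b∈P* → insert-0-image {b} b∈P* (loop⇒≡0 {b} loop b∈P*)
      } )
  , λ nl →
    isCycleSystem-contract cs nl
  , record
      { mapsTo    = λ {a} → P*-increment⁺ C only a
      ; injective = λ {a} {b} _ _ eq → trans (sym (updateAt-pred∘suc a i))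
                      (trans (cong (λ c → updateAt c i pred) eq) (updateAt-pred∘suc b i))
      }
  , ( (λ { (a , a∈P* , refl) → P*-increment⁺ C only a a∈P* ,
                               subst (_> 0) (sym (lookup∘updateAt i a)) (s≤s z≤n) })
    , λ {b} (b∈P* , bi>0) → updateAt b i pred , decrement {b} b∈P* bi>0 , updateAt-suc∘pred b i bi>0 )
  where
  only : OnlyIn C i e
  only = let e∈U , e∈Ci = x∈p∩q⁻ (uniqueUnion C ⊤) (lookup C i) e∈
         in  ∈-uniqueUnion-⊤⇒OnlyIn C e∈U e∈Ci

  insert-0-injective : IsInjectiveMap (λ a → insertAt a i 0) (P* (removeAt C i)) (P* C)
  insert-0-injective = record
    { mapsTo    = λ {a} → P*-insertAt-0⁺ C a only
    ; injective = λ {a} {b} _ _ eq → trans (sym (removeAt-insertAt a i 0))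
                    (trans (cong (λ c → removeAt c i) eq) (removeAt-insertAt b i 0))
    }

  insert-0-image : ∀ {b} → P* C b → lookup b i ≡ 0 →
                   Image (λ a → insertAt a i 0) (P* (removeAt C i)) b
  insert-0-image {b} b∈P* bi≡0 =
    -- The preimage forgets coordinate i, which `bi≡0` allows to be restored as 0.
    removeAt b i , P*-insertAt⁻ C (removeAt b i) (subst (P* C) (sym b≡) b∈P*) , b≡
    where b≡ = insertAt-removeAt-≡ b i bi≡0

  decrement : ∀ {b} → P* C b → lookup b i > 0 → P* (map (_- e) C) (updateAt b i pred)
  decrement {b} b∈P* bi>0 =
    P*-increment⁻ C only (updateAt b i pred) (subst (P* C) (sym (updateAt-suc∘pred b i bi>0)) b∈P*)

  -- `P*` depends on the family alone, so `decrement` applies even though a loop e is not contracted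
  -- here. A positive `b_i` would make every unique union nonempty after removal of e, against
  -- `loop-uniqueUnion`.
  loop⇒≡0 : ∀ {b} → Loop M e → P* C b → lookup b i ≡ 0
  loop⇒≡0 {b} (dep , _) b∈P* with lookup b i in eq
  ... | zero  = refl
  ... | suc m = contradiction
    (λ σ ne → subst Nonempty (uniqueUnion-map-remove C σ e)
       (P*⇒Nonempty-uniqueUnion (map (_- e) C) {updateAt b i pred} (decrement {b} b∈P* bi>0) σ ne))
    (loop-uniqueUnion cs dep)
    where
    bi>0 : lookup b i > 0
    bi>0 = subst (_> 0) (sym eq) (s≤s z≤n)
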